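{- For all integers $n\geq 0$, $p_{\mathrm{ed}}^{\mathrm{od}}(n)\leq p^{\mathrm{ed}}_{\mathrm{od}}(n)$. Moreover, $p_{\mathrm{ed}}^{\mathrm{od}}(n)< p^{\mathrm{ed}}_{\mathrm{od}}(n)$ for all $n\geq 11$.
   Context: A partition of a non-negative integer $n$ is a non-increasing (finite, possibly empty) sequence of positive integers, called parts, summing to $n$. $p_{\mathrm{ed}}^{\mathrm{od}}(n)$ is the number of partitions of $n$ in which every odd part is larger than every even part, the odd parts are pairwise distinct, and the even parts are pairwise distinct. $p^{\mathrm{ed}}_{\mathrm{od}}(n)$ is the number of partitions of $n$ in which every even part is larger than every odd part, the even parts are pairwise distinct, and the odd parts are pairwise distinct. In both cases partitions with no even parts or with no odd parts are allowed. -}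

module Defs where

open import Data.Empty using (⊥)
open import Data.List.Base using (List; []; _∷_; [_]; length; filter; concatMap)
open import Data.List.Membership.Propositional using (_∈_; find; lose)
open import Data.List.Membership.Propositional.Properties
  using (∈-filter⁺; ∈-filter⁻; ∈-concatMap⁺; ∈-concatMap⁻)
open import Data.List.Relation.Unary.All as All using (All; []; _∷_; all?)
open import Data.List.Relation.Unary.AllPairs using ([]; _∷_)
open import Data.List.Relation.Unary.Any using (here; there)
open import Data.List.Relation.Unary.Linked using (Linked; linked?)
open import Data.List.Relation.Unary.Unique.Propositional using (Unique)
open import Data.List.Relation.Unary.Unique.Propositional.Properties using (filter⁺; ++⁺)
open import Data.Nat.Base using (ℕ; zero; suc; _<_; _≥_; z≤n; s≤s; parity)
open import Data.Nat.ListAction using (sum)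
open import Data.Nat.Properties using (_≟_; _<?_; _≥?_; suc-injective; 1+n≢n)
open import Data.Parity.Base using (0ℙ; 1ℙ)
import Data.Parity.Properties as Parity
open import Data.Product.Base using (_×_; _,_; proj₁; proj₂)
open import Function.Bundles using (_⇔_; mk⇔)
open import Relation.Binary.PropositionalEquality.Core using (_≡_; refl; sym; trans; cong)
open import Relation.Nullary.Decidable using (_×-dec_; _→-dec_)
open import Relation.Unary using (Decidable)

open import Data.List.Relation.Unary.Unique.DecPropositional _≟_ using (unique?)

record IsPartition (n : ℕ) (xs : List ℕ) : Set where
  constructor isPartition
  field
    nonIncreasing : Linked _≥_ xs
    positive      : All (0 <_) xs
    sums          : sum xs ≡ n

Even Odd : ℕ → Set
Even m = parity m ≡ 0ℙ
Odd  m = parity m ≡ 1ℙ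

even? : Decidable Even
even? m = parity m Parity.≟ 0ℙ

odd? : Decidable Odd
odd? m = parity m Parity.≟ 1ℙ

OddsAboveEvens EvensAboveOdds DistinctOdds DistinctEvens : List ℕ → Set
OddsAboveEvens xs = All (λ a → All (λ b → Odd a → Even b → b < a) xs) xs
EvensAboveOdds xs = All (λ a → All (λ b → Even a → Odd b → b < a) xs) xs
DistinctOdds   xs = Unique (filter odd? xs)
DistinctEvens  xs = Unique (filter even? xs)

OD/ED ED/OD : List ℕ → Set
OD/ED xs = OddsAboveEvens xs × DistinctOdds xs × DistinctEvens xs
ED/OD xs = EvensAboveOdds xs × DistinctEvens xs × DistinctOdds xs

OD/ED? : Decidable OD/ED
OD/ED? xs =
  all? (λ a → all? (λ b → odd? a →-dec (even? b →-dec (b <? a))) xs) xs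
  ×-dec unique? (filter odd? xs) ×-dec unique? (filter even? xs)

ED/OD? : Decidable ED/OD
ED/OD? xs =
  all? (λ a → all? (λ b → even? a →-dec (odd? b →-dec (b <? a))) xs) xs
  ×-dec unique? (filter even? xs) ×-dec unique? (filter odd? xs)

-- Every composition (ordered sequence of positive integers) of suc n arises
-- from exactly one composition of n, either by prepending a part 1 or by
-- incrementing the first part.
extend : List ℕ → List (List ℕ)
extend []       = [ 1 ∷ [] ]
extend (x ∷ xs) = (1 ∷ x ∷ xs) ∷ (suc x ∷ xs) ∷ []

compositions : ℕ → List (List ℕ)
compositions zero    = [ [] ]
compositions (suc n) = concatMap extend (compositions n)

-- By ∈-partitions and partitions-unique below, this lists each partition of n
-- exactly once, so that lengths of its filtered sublists count partitions.
partitions : ℕ → List (List ℕ)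
partitions n = filter (linked? _≥?_) (compositions n)

-- In the name of a count, the class before "/" consists of the larger parts:
-- p-od/ed has superscript od and subscript ed, p-ed/od the other way round.
p-od/ed p-ed/od : ℕ → ℕ
p-od/ed n = length (filter OD/ED? (partitions n))
p-ed/od n = length (filter ED/OD? (partitions n))

private
  extend-sound : ∀ {n xs ys} → All (0 <_) xs → sum xs ≡ n → ys ∈ extend xs →
                 All (0 <_) ys × sum ys ≡ suc n
  extend-sound {xs = []}    ps       eq (here refl) = s≤s z≤n ∷ ps , cong suc eq
  extend-sound {xs = _ ∷ _} ps       eq (here refl) = s≤s z≤n ∷ ps , cong suc eq
  extend-sound {xs = _ ∷ _} (_ ∷ ps) eq (there (here refl)) = s≤s z≤n ∷ ps , cong suc eq

  compositions-sound : ∀ n {xs} → xs ∈ compositions n → All (0 <_) xs × sum xs ≡ n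
  compositions-sound zero    (here refl) = [] , refl
  compositions-sound (suc n) ys∈
    with _ , xs∈ , ys∈xs ← find (∈-concatMap⁻ extend {xs = compositions n} ys∈)
    with ps , eq ← compositions-sound n xs∈ = extend-sound ps eq ys∈xs

  compositions-complete : ∀ n {xs} → All (0 <_) xs → sum xs ≡ n → xs ∈ compositions n
  compositions-complete zero    {[]}              _        _  = here refl
  compositions-complete zero    {zero ∷ _}        (() ∷ _) _
  compositions-complete (suc n) {zero ∷ _}        (() ∷ _) _
  compositions-complete (suc n) {1 ∷ []}          (_ ∷ ps) eq =
    ∈-concatMap⁺ extend
      (lose (compositions-complete n ps (suc-injective eq)) (here refl))
  compositions-complete (suc n) {1 ∷ _ ∷ _}       (_ ∷ ps) eq =
    ∈-concatMap⁺ extend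
      (lose (compositions-complete n ps (suc-injective eq)) (here refl))
  compositions-complete (suc n) {suc (suc _) ∷ _} (_ ∷ ps) eq =
    ∈-concatMap⁺ extend
      (lose (compositions-complete n (s≤s z≤n ∷ ps) (suc-injective eq)) (there (here refl)))

  collapse : List ℕ → List ℕ
  collapse (suc (suc x) ∷ xs) = suc x ∷ xs
  collapse (_ ∷ xs)           = xs
  collapse []                 = []

  collapse-extend : ∀ {xs ys} → All (0 <_) xs → ys ∈ extend xs → collapse ys ≡ xs
  collapse-extend {[]}        _ (here refl)         = refl
  collapse-extend {_ ∷ _}     _ (here refl)         = refl
  collapse-extend {suc _ ∷ _} _ (there (here refl)) = refl
  collapse-extend {zero ∷ _}  (() ∷ _) (there _)

  extend-unique : ∀ xs → Unique (extend xs)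
  extend-unique []       = [] ∷ []
  extend-unique (x ∷ xs) = ((λ eq → 1+n≢n (cong length eq)) ∷ []) ∷ [] ∷ []

  concatMap-extend-unique : ∀ {xss} → All (All (0 <_)) xss → Unique xss →
                            Unique (concatMap extend xss)
  concatMap-extend-unique []         []         = []
  concatMap-extend-unique {xs ∷ xss} (ps ∷ pss) (xs∉ ∷ us) =
    ++⁺ (extend-unique xs) (concatMap-extend-unique pss us) disjoint
    where
    disjoint : ∀ {ys} → ys ∈ extend xs × ys ∈ concatMap extend xss → ⊥
    disjoint (ys∈ , ys∈′) with zs , zs∈ , ys∈zs ← find (∈-concatMap⁻ extend {xs = xss} ys∈′) =
      All.lookup xs∉ zs∈
        (trans (sym (collapse-extend ps ys∈)) (collapse-extend (All.lookup pss zs∈) ys∈zs))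

  compositions-unique : ∀ n → Unique (compositions n)
  compositions-unique zero    = [] ∷ []
  compositions-unique (suc n) = concatMap-extend-unique
    (All.tabulate (λ xs∈ → proj₁ (compositions-sound n xs∈))) (compositions-unique n)

∈-partitions : ∀ {n xs} → xs ∈ partitions n ⇔ IsPartition n xs
∈-partitions {n} = mk⇔
  (λ xs∈ → let xs∈′ , l = ∈-filter⁻ (linked? _≥?_) {xs = compositions n} xs∈
               ps , eq  = compositions-sound n xs∈′
           in isPartition l ps eq)
  (λ (isPartition l ps eq) → ∈-filter⁺ (linked? _≥?_) (compositions-complete n ps eq) l)

partitions-unique : ∀ n → Unique (partitions n)
partitions-unique n = filter⁺ (linked? _≥?_) (compositions-unique n)

{-# OPTIONS --safe #-}

-- Write each part x as 2j + 1 or 2j + 2, so that j = half x.  Partitions with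
-- the odd parts on top then correspond to an arbitrary strictly decreasing list
-- of values j together with the number m of (smallest) parts that are even.  If
-- there is at least one odd part, turn the largest m values of j into even parts
-- 2j and the others into odd parts 2j + 1; this lowers the sum by 2m, which is
-- compensated by first adding m to the largest j.  If there is no odd part, the
-- partition is left alone.  The map is injective, and a partition with the even
-- parts on top and some odd part is missed as soon as its two largest values of
-- j differ by at most m.
module Submission where

open import Defs
open import Data.Fin.Patterns using (0F; 1F; 2F; 3F)
open import Data.List.Base using (List; []; _∷_; length; filter; map)
open import Data.List.Membership.Propositional using (_∈_)
open import Data.List.Membership.Propositional.Properties
  using (∈-filter⁺; ∈-filter⁻; ∈-map⁻)
open import Data.List.Properties
  using (≡-dec; length-map; filter-accept; filter-reject; filter-none; filter-notAll; ∷-injective)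
open import Data.List.Relation.Binary.Subset.Propositional using (_⊆_)
open import Data.List.Relation.Unary.All as All using (All; []; _∷_)
import Data.List.Relation.Unary.All.Properties as All
open import Data.List.Relation.Unary.AllPairs as AllPairs using (AllPairs; []; _∷_)
open import Data.List.Relation.Unary.Any as Any using (here; there)
open import Data.List.Relation.Unary.Linked using (Linked)
open import Data.List.Relation.Unary.Linked.Properties using (AllPairs⇒Linked; Linked⇒AllPairs)
open import Data.List.Relation.Unary.Unique.Propositional using (Unique)
import Data.List.Relation.Unary.Unique.Propositional.Properties as Unique
open import Data.Nat.Base using (ℕ; zero; suc; pred; parity; _+_; _*_; _∸_; _≤_; _<_; _>_; _≥_; z≤n; s≤s; ⌊_/2⌋)
open import Data.Nat.DivMod using (_divMod_; result)
open import Data.Nat.ListAction using (sum)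
open import Data.Nat.Properties
open import Data.Nat.Tactic.RingSolver using (solve-∀)
open import Data.Parity.Base using (0ℙ; 1ℙ)
open import Data.Product.Base using (_×_; _,_; proj₁; proj₂)
open import Data.Sum.Base using (_⊎_; inj₁; inj₂)
open import Function.Base using (_∘_)
open import Function.Bundles using (Equivalence)
open import Relation.Binary.Definitions using (DecidableEquality)
open import Relation.Binary.PropositionalEquality
  using (_≡_; _≢_; refl; sym; trans; cong; cong₂; subst; subst₂; module ≡-Reasoning)
open import Relation.Nullary using (¬_; contradiction)
open import Relation.Nullary.Decidable using (¬?)

-- Comparing lengths of duplicate-free lists.

module _ {A : Set} (_≟A_ : DecidableEquality A) where

  -- Remove every copy of the head `x` from `ys`. The tail still embeds in what is left because `x`
  -- does not recur in it, and the filter shortens `ys` because `x` occurs there.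
  length-mono-⊆ : ∀ {xs ys : List A} → Unique xs → xs ⊆ ys → length xs ≤ length ys
  length-mono-⊆ {[]}              []         _     = z≤n
  length-mono-⊆ {x ∷ xs} {ys} (x∉xs ∷ u) xs⊆ys = ≤-<-trans
    (length-mono-⊆ u λ y∈xs →
      ∈-filter⁺ (¬? ∘ (x ≟A_)) (xs⊆ys (there y∈xs)) (All.lookup x∉xs y∈xs))
    (filter-notAll (¬? ∘ (x ≟A_)) ys (Any.map (λ x≡y x≢y → x≢y x≡y) (xs⊆ys (here refl))))

module _ {A B : Set} {f : A → B} where

  -- Injectivity is asked only between members of the list, since for `swap` it is established only
  -- on `Sources n`.
  map-unique : ∀ {xs} → (∀ {x y} → x ∈ xs → y ∈ xs → f x ≡ f y → x ≡ y) →
               Unique xs → Unique (map f xs)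
  map-unique inj []         = []
  map-unique inj (x∉xs ∷ u) =
    All.map⁺ (All.tabulate λ y∈xs eq →
      All.lookup x∉xs y∈xs (inj (here refl) (there y∈xs) eq))
    ∷ map-unique (λ x∈ y∈ → inj (there x∈) (there y∈)) u

AllPairs-lookup : ∀ {A : Set} {R : A → A → Set} {xs x y} → AllPairs R xs →
                  x ∈ xs → y ∈ xs → x ≡ y ⊎ (R x y ⊎ R y x)
AllPairs-lookup (_ ∷ _)   (here refl) (here refl) = inj₁ refl
AllPairs-lookup (rs ∷ _)  (here refl) (there y∈)  = inj₂ (inj₁ (All.lookup rs y∈))
AllPairs-lookup (rs ∷ _)  (there x∈)  (here refl) = inj₂ (inj₂ (All.lookup rs x∈))
AllPairs-lookup (_ ∷ rss) (there x∈)  (there y∈)  = AllPairs-lookup rss x∈ y∈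

-- Parities, halves, and counts of even and odd parts.

even⇒¬odd : ∀ x → Even x → ¬ Odd x
even⇒¬odd x e o with () ← trans (sym e) o

even⊎odd : ∀ x → Even x ⊎ Odd x
even⊎odd x with parity x
... | 0ℙ = inj₁ refl
... | 1ℙ = inj₂ refl

even-double : ∀ j → Even (j + j)
even-double zero    = refl
even-double (suc j) rewrite +-suc j j = even-double j

odd-1+double : ∀ j → Odd (suc (j + j))
odd-1+double zero    = refl
odd-1+double (suc j) rewrite +-suc j j = odd-1+double j

half : ℕ → ℕ
half x = ⌊ pred x /2⌋

odd-half : ∀ x → Odd x → x ≡ suc (half x + half x)
odd-half 1                   _ = refl
odd-half (suc (suc (suc x))) o =
  cong (suc ∘ suc) (trans (odd-half (suc x) o) (sym (+-suc ⌊ x /2⌋ ⌊ x /2⌋)))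

even-half : ∀ {x} → 0 < x → Even x → x ≡ suc (suc (half x + half x))
even-half {2}                       _ _ = refl
even-half {suc (suc (suc (suc x)))} _ e =
  cong (suc ∘ suc) (trans (even-half {suc (suc x)} (s≤s z≤n) e)
    (cong suc (sym (+-suc ⌊ suc x /2⌋ ⌊ suc x /2⌋))))

#even #odd : List ℕ → ℕ
#even xs = length (filter even? xs)
#odd  xs = length (filter odd? xs)

#even-even : ∀ x xs → Even x → #even (x ∷ xs) ≡ suc (#even xs)
#even-even x xs e = cong length (filter-accept even? {x} {xs} e)

#even-odd : ∀ x xs → Odd x → #even (x ∷ xs) ≡ #even xs
#even-odd x xs o = cong length (filter-reject even? {x} {xs} λ e → even⇒¬odd x e o)

#odd-even : ∀ x xs → Even x → #odd (x ∷ xs) ≡ #odd xs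
#odd-even x xs e = cong length (filter-reject odd? {x} {xs} (even⇒¬odd x e))

#odd-odd : ∀ x xs → Odd x → #odd (x ∷ xs) ≡ suc (#odd xs)
#odd-odd x xs o = cong length (filter-accept odd? {x} {xs} o)

#odd-all-even : ∀ xs → All Even xs → #odd xs ≡ 0
#odd-all-even xs es = cong length (filter-none odd? {xs} (All.map (λ {x} → even⇒¬odd x) es))

#even+#odd : ∀ xs → #even xs + #odd xs ≡ length xs
#even+#odd []       = refl
#even+#odd (x ∷ xs) with parity x
... | 0ℙ = cong suc (#even+#odd xs)
... | 1ℙ = trans (+-suc (#even xs) (#odd xs)) (cong suc (#even+#odd xs))

-- Both classes of partitions as pairwise relations.

-- Two equal parts share a parity, so they would already clash inside one of the filtered lists.
unique-by-parity : ∀ {xs} → Unique (filter odd? xs) → Unique (filter even? xs) → Unique xs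
unique-by-parity {[]}     _  _  = []
unique-by-parity {x ∷ xs} uo ue with parity x in eq | uo | ue
... | 0ℙ | uo′       | x∉ ∷ ue′ =
  All.tabulate (λ y∈ x≡y → All.lookup x∉ (∈-filter⁺ even? y∈ (subst Even x≡y eq)) x≡y)
  ∷ unique-by-parity uo′ ue′
... | 1ℙ | x∉ ∷ uo′  | ue′      =
  All.tabulate (λ y∈ x≡y → All.lookup x∉ (∈-filter⁺ odd? y∈ (subst Odd x≡y eq)) x≡y)
  ∷ unique-by-parity uo′ ue′

-- Relations between a part `x` and a later part `y`. Strict decrease absorbs both distinctness
-- conditions, and parity is tested one way only: once the lower class begins, it continues to the
-- end.
OddFirst EvenFirst : ℕ → ℕ → Set
OddFirst  x y = y < x × (Even x → Even y)
EvenFirst x y = y < x × (Odd x → Odd y)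

OD/ED⇒OddFirst : ∀ {xs} → Linked _≥_ xs → OD/ED xs → AllPairs OddFirst xs
OD/ED⇒OddFirst l (above , uo , ue) =
  go (Linked⇒AllPairs (λ x≥y y≥z → ≤-trans y≥z x≥y) l) (unique-by-parity uo ue) above
  where
  go : ∀ {xs} → AllPairs _≥_ xs → Unique xs → OddsAboveEvens xs → AllPairs OddFirst xs
  go {[]}     _          _          _             = []
  go {x ∷ xs} (≥s ∷ ≥ss) (x∉xs ∷ u) (_ ∷ above) =
    All.tabulate first ∷ go ≥ss u (All.map All.tail above)
    where
    first : ∀ {y} → y ∈ xs → OddFirst x y
    first {y} y∈ = y<x , λ e → even e (even⊎odd y)
      where
      y<x = ≤∧≢⇒< (All.lookup ≥s y∈) (All.lookup x∉xs y∈ ∘ sym)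
      even : Even x → Even y ⊎ Odd y → Even y
      even _ (inj₁ e) = e
      -- An odd `y` after an even `x` would have to be the larger of the two.
      even e (inj₂ o) =
        contradiction (All.head (All.lookup above y∈) o e) (<-asym y<x)

EvenFirst⇒ED/OD : ∀ {xs} → AllPairs EvenFirst xs → ED/OD xs
EvenFirst⇒ED/OD {xs} ps =
    All.tabulate (λ a∈ → All.tabulate λ b∈ → above (AllPairs-lookup ps a∈ b∈))
  , Unique.filter⁺ even? unique , Unique.filter⁺ odd? unique
  where
  unique : Unique xs
  unique = AllPairs.map (λ (y<x , _) x≡y → <⇒≢ y<x (sym x≡y)) ps

  above : ∀ {a b} → a ≡ b ⊎ (EvenFirst a b ⊎ EvenFirst b a) → Even a → Odd b → b < a
  above {a} (inj₁ refl)                e o = contradiction o (even⇒¬odd a e)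
  above     (inj₂ (inj₁ (b<a , _)))    _ _ = b<a
  above {a} (inj₂ (inj₂ (_ , odd)))    e o = contradiction (odd o) (even⇒¬odd a e)

-- Halves of the parts of a source partition.

-- Positive `y < x` have equal halves only as `2j + 1` and `2j + 2`; an even part followed by an odd
-- one is exactly what `OddFirst` forbids.
half-< : ∀ {x y} → 0 < x → 0 < y → OddFirst x y → half y < half x
half-< {x} {y} x>0 y>0 (y<x , even) =
  ≰⇒> λ hx≤hy → <⇒≱ y<x (bound (+-mono-≤ hx≤hy hx≤hy) (even⊎odd x) (even⊎odd y))
  where
  open ≤-Reasoning
  bound : half x + half x ≤ half y + half y → Even x ⊎ Odd x → Even y ⊎ Odd y → x ≤ y
  bound le (inj₁ ex) _ = begin
    x                           ≡⟨ even-half x>0 ex ⟩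
    suc (suc (half x + half x)) ≤⟨ s≤s (s≤s le) ⟩
    suc (suc (half y + half y)) ≡⟨ even-half y>0 (even ex) ⟨
    y                           ∎
  bound le (inj₂ ox) (inj₁ ey) = begin
    x                           ≡⟨ odd-half x ox ⟩
    suc (half x + half x)       ≤⟨ s≤s (m≤n⇒m≤1+n le) ⟩
    suc (suc (half y + half y)) ≡⟨ even-half y>0 ey ⟨
    y                           ∎
  bound le (inj₂ ox) (inj₂ oy) = begin
    x                           ≡⟨ odd-half x ox ⟩
    suc (half x + half x)       ≤⟨ s≤s le ⟩
    suc (half y + half y)       ≡⟨ odd-half y oy ⟨
    y                           ∎

-- Beyond twice its half, every part contributes 1, and every even part one more.
sum-half : ∀ {xs} → All (0 <_) xs →
           sum xs ≡ sum (map half xs) + sum (map half xs) + length xs + #even xs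
sum-half []                     = refl
sum-half {x ∷ xs} (x>0 ∷ xs>0) with even⊎odd x
... | inj₁ e = begin
  x + sum xs                            ≡⟨ cong₂ _+_ (even-half x>0 e) (sum-half xs>0) ⟩
  suc (suc (h + h)) + (H + H + n + m)   ≡⟨ shift h H n m ⟩
  h + H + (h + H) + suc n + suc m       ≡⟨ cong (h + H + (h + H) + suc n +_) (#even-even x xs e) ⟨
  h + H + (h + H) + suc n + #even (x ∷ xs) ∎
  where
  open ≡-Reasoning
  h = half x ; H = sum (map half xs) ; n = length xs ; m = #even xs
  shift : ∀ h H n m → suc (suc (h + h)) + (H + H + n + m) ≡ h + H + (h + H) + suc n + suc m
  shift = solve-∀
... | inj₂ o = begin
  x + sum xs                            ≡⟨ cong₂ _+_ (odd-half x o) (sum-half xs>0) ⟩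
  suc (h + h) + (H + H + n + m)         ≡⟨ shift h H n m ⟩
  h + H + (h + H) + suc n + m           ≡⟨ cong (h + H + (h + H) + suc n +_) (#even-odd x xs o) ⟨
  h + H + (h + H) + suc n + #even (x ∷ xs) ∎
  where
  open ≡-Reasoning
  h = half x ; H = sum (map half xs) ; n = length xs ; m = #even xs
  shift : ∀ h H n m → suc (h + h) + (H + H + n + m) ≡ h + H + (h + H) + suc n + m
  shift = solve-∀

halves-decreasing : ∀ {xs} → All (0 <_) xs → AllPairs OddFirst xs → AllPairs _>_ (map half xs)
halves-decreasing []           []         = []
halves-decreasing (x>0 ∷ xs>0) (ps ∷ pss) =
  All.map⁺ (All.zipWith (λ (y>0 , p) → half-< x>0 y>0 p) (xs>0 , ps))
  ∷ halves-decreasing xs>0 pss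

-- An even head forces the whole list to be even, so the number of odd parts
-- decides the parity of the head.
halves-injective : ∀ {xs ys} → All (0 <_) xs → All (0 <_) ys →
                   AllPairs OddFirst xs → AllPairs OddFirst ys →
                   #odd xs ≡ #odd ys → map half xs ≡ map half ys → xs ≡ ys
halves-injective {[]}     {[]}     _ _ _ _ _ _ = refl
halves-injective {x ∷ xs} {y ∷ ys} (x>0 ∷ xs>0) (y>0 ∷ ys>0) (ps ∷ pss) (qs ∷ qss) #≡ h≡
  with hx≡hy , hxs≡hys ← ∷-injective h≡
  with even⊎odd x | even⊎odd y
... | inj₁ ex | inj₁ ey = cong₂ _∷_
  (trans (even-half x>0 ex) (trans (cong (λ j → suc (suc (j + j))) hx≡hy) (sym (even-half y>0 ey))))
  (halves-injective xs>0 ys>0 pss qss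
    (trans (sym (#odd-even x xs ex)) (trans #≡ (#odd-even y ys ey))) hxs≡hys)
... | inj₂ ox | inj₂ oy = cong₂ _∷_
  (trans (odd-half x ox) (trans (cong (λ j → suc (j + j)) hx≡hy) (sym (odd-half y oy))))
  (halves-injective xs>0 ys>0 pss qss
    (suc-injective (trans (sym (#odd-odd x xs ox)) (trans #≡ (#odd-odd y ys oy)))) hxs≡hys)
... | inj₁ ex | inj₂ oy
  with () ← trans (sym (#odd-all-even (x ∷ xs) (ex ∷ All.map (λ p → proj₂ p ex) ps))) (trans #≡ (#odd-odd y ys oy))
... | inj₂ ox | inj₁ ey
  with () ← trans (sym (#odd-all-even (y ∷ ys) (ey ∷ All.map (λ q → proj₂ q ey) qs))) (trans (sym #≡) (#odd-odd x xs ox))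

-- Building target partitions from decreasing values.

-- Even parts are now coded as `2j`, not `2j + 2`. With the evens on top, a part may be followed by
-- the odd number just below it, such as 4 and 3, whose `half` values coincide while their `⌊_/2⌋`
-- values do not.
evensFirst : ℕ → List ℕ → List ℕ
evensFirst zero    js       = map (λ j → suc (j + j)) js
evensFirst (suc m) []       = []
evensFirst (suc m) (j ∷ js) = (j + j) ∷ evensFirst m js

map-⌊/2⌋-evensFirst : ∀ m js → map ⌊_/2⌋ (evensFirst m js) ≡ js
map-⌊/2⌋-evensFirst zero    []       = refl
map-⌊/2⌋-evensFirst zero    (j ∷ js) = cong₂ _∷_ (sym (n≡⌈n+n/2⌉ j)) (map-⌊/2⌋-evensFirst zero js)
map-⌊/2⌋-evensFirst (suc m) []       = refl
map-⌊/2⌋-evensFirst (suc m) (j ∷ js) = cong₂ _∷_ (sym (n≡⌊n+n/2⌋ j)) (map-⌊/2⌋-evensFirst m js)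

length-evensFirst : ∀ m js → length (evensFirst m js) ≡ length js
length-evensFirst m js =
  trans (sym (length-map ⌊_/2⌋ (evensFirst m js))) (cong length (map-⌊/2⌋-evensFirst m js))

#even-evensFirst : ∀ {m js} → m ≤ length js → #even (evensFirst m js) ≡ m
#even-evensFirst {zero}  {js}     _        = cong length (filter-none even? (All.map⁺
  (All.universal (λ j e → even⇒¬odd (suc (j + j)) e (odd-1+double j)) js)))
#even-evensFirst {suc m} {j ∷ js} (s≤s m≤) =
  trans (#even-even (j + j) (evensFirst m js) (even-double j)) (cong suc (#even-evensFirst m≤))

-- Each part contributes `2j`, and each odd part a further 1. Adding `m` on the left supplies the 1
-- missing from the even parts and avoids truncated subtraction.
sum-evensFirst : ∀ {m js} → m ≤ length js →
                 sum (evensFirst m js) + m ≡ sum js + sum js + length js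
sum-evensFirst {zero}  {[]}     _ = refl
sum-evensFirst {zero}  {j ∷ js} _ = begin
  suc (j + j) + S + 0         ≡⟨ +-assoc (suc (j + j)) S 0 ⟩
  suc (j + j) + (S + 0)       ≡⟨ cong (suc (j + j) +_) (sum-evensFirst {zero} {js} z≤n) ⟩
  suc (j + j) + (J + J + n)   ≡⟨ shift j J n ⟩
  j + J + (j + J) + suc n     ∎
  where
  open ≡-Reasoning
  S = sum (evensFirst zero js) ; J = sum js ; n = length js
  shift : ∀ j J n → suc (j + j) + (J + J + n) ≡ j + J + (j + J) + suc n
  shift = solve-∀
sum-evensFirst {suc m} {j ∷ js} (s≤s m≤) = begin
  j + j + S + suc m           ≡⟨ regroup j S m ⟩
  suc (j + j) + (S + m)       ≡⟨ cong (suc (j + j) +_) (sum-evensFirst m≤) ⟩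
  suc (j + j) + (J + J + n)   ≡⟨ shift j J n ⟩
  j + J + (j + J) + suc n     ∎
  where
  open ≡-Reasoning
  S = sum (evensFirst m js) ; J = sum js ; n = length js
  regroup : ∀ j S m → j + j + S + suc m ≡ suc (j + j) + (S + m)
  regroup = solve-∀
  shift : ∀ j J n → suc (j + j) + (J + J + n) ≡ j + J + (j + J) + suc n
  shift = solve-∀

-- Only the last value of a strictly decreasing list can be 0, and the strict bound on `m` leaves
-- that value odd, where 0 becomes the part 1.
evensFirst-positive : ∀ {m js} → m < length js → AllPairs _>_ js → All (0 <_) (evensFirst m js)
evensFirst-positive {zero}  {js} _ _ = All.map⁺ (All.universal (λ _ → s≤s z≤n) js)
evensFirst-positive {suc m} {suc j ∷ i ∷ js} (s≤s m<) (_ ∷ ps) =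
  s≤s z≤n ∷ evensFirst-positive m< ps
evensFirst-positive {suc m} {zero ∷ i ∷ js}  _        ((() ∷ _) ∷ _)
evensFirst-positive {suc m} {j ∷ []}         (s≤s ()) _

evensFirst-EvenFirst : ∀ m {js} → AllPairs _>_ js → AllPairs EvenFirst (evensFirst m js)
evensFirst-EvenFirst zero    []       = []
evensFirst-EvenFirst zero    (ps ∷ pss) =
  All.map⁺ (All.map (λ {i} i<j → s≤s (+-mono-< i<j i<j) , λ _ → odd-1+double i) ps)
  ∷ evensFirst-EvenFirst zero pss
evensFirst-EvenFirst (suc m) []         = []
evensFirst-EvenFirst (suc m) {j ∷ js} (ps ∷ pss) =
  All.map (_, λ o → contradiction o (even⇒¬odd (j + j) (even-double j))) (below m ps)
  ∷ evensFirst-EvenFirst m pss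
  where
  below : ∀ m {is} → All (_< j) is → All (_< j + j) (evensFirst m is)
  -- Used once as `suc i ≤ j` and once as `i < j`, the hypothesis gives `suc (i + i) < j + j`.
  below zero    qs         = All.map⁺ (All.map (λ i<j → +-mono-≤-< i<j i<j) qs)
  below (suc m) []         = []
  below (suc m) (i<j ∷ qs) = +-mono-< i<j i<j ∷ below m qs

evensFirst-∈ : ∀ {m js n} → m < length js → AllPairs _>_ js → sum (evensFirst m js) ≡ n →
               evensFirst m js ∈ filter ED/OD? (partitions n)
evensFirst-∈ {m} m< js> eq = ∈-filter⁺ ED/OD?
  (Equivalence.from ∈-partitions (isPartition
    (AllPairs⇒Linked (AllPairs.map (<⇒≤ ∘ proj₁) ps)) (evensFirst-positive m< js>) eq))
  (EvenFirst⇒ED/OD ps)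
  where ps = evensFirst-EvenFirst m js>

-- Both arguments can be read off the result: `m` by counting even parts, the values by `⌊_/2⌋`.
evensFirst-injective : ∀ {m m′ js js′} → m ≤ length js → m′ ≤ length js′ →
                       evensFirst m js ≡ evensFirst m′ js′ → m ≡ m′ × js ≡ js′
evensFirst-injective {m} {m′} {js} {js′} m≤ m′≤ eq =
    trans (sym (#even-evensFirst m≤)) (trans (cong #even eq) (#even-evensFirst m′≤))
  , trans (sym (map-⌊/2⌋-evensFirst m js))
      (trans (cong (map ⌊_/2⌋) eq) (map-⌊/2⌋-evensFirst m′ js′))

-- The map from source to target partitions.

raise : ℕ → List ℕ → List ℕ
raise m []       = []
raise m (j ∷ js) = m + j ∷ js

raise-injective : ∀ m js is → raise m js ≡ raise m is → js ≡ is
raise-injective m []       []       _  = refl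
raise-injective m (j ∷ js) (i ∷ is) eq with m+j≡m+i , js≡is ← ∷-injective eq =
  cong₂ _∷_ (+-cancelˡ-≡ m j i m+j≡m+i) js≡is

length-raise : ∀ m js → length (raise m js) ≡ length js
length-raise m []      = refl
length-raise m (_ ∷ _) = refl

sum-raise : ∀ m js → 0 < length js → sum (raise m js) ≡ m + sum js
sum-raise m (j ∷ js) _ = +-assoc m j (sum js)

raise-decreasing : ∀ m {js} → AllPairs _>_ js → AllPairs _>_ (raise m js)
raise-decreasing m []                = []
raise-decreasing m {j ∷ _} (ps ∷ pss) = All.map (λ i<j → m≤n⇒m≤o+n m i<j) ps ∷ pss

-- Without odd parts the formula of the second case could create a part 0, for instance from 4, 2. A
-- source partition with only even parts lies in the target class already.
swap : List ℕ → List ℕ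
swap xs with #odd xs
... | zero  = xs
... | suc _ = evensFirst (#even xs) (raise (#even xs) (map half xs))

swap-no-odd : ∀ xs → #odd xs ≡ 0 → swap xs ≡ xs
swap-no-odd xs eq rewrite eq = refl

swap-some-odd : ∀ xs {k} → #odd xs ≡ suc k →
                swap xs ≡ evensFirst (#even xs) (raise (#even xs) (map half xs))
swap-some-odd xs eq rewrite eq = refl

length-raised : ∀ xs → length (raise (#even xs) (map half xs)) ≡ length xs
length-raised xs = trans (length-raise (#even xs) (map half xs)) (length-map half xs)

#even≤length : ∀ xs → #even xs ≤ length xs
#even≤length xs = subst (#even xs ≤_) (#even+#odd xs) (m≤m+n _ _)

#even<length : ∀ xs {k} → #odd xs ≡ suc k → #even xs < length xs
#even<length xs {k} eq = subst (#even xs <_)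
  (trans (cong (#even xs +_) (sym eq)) (#even+#odd xs)) (m<m+n (#even xs) (s≤s z≤n))

#even≤raised : ∀ xs → #even xs ≤ length (raise (#even xs) (map half xs))
#even≤raised xs = subst (#even xs ≤_) (sym (length-raised xs)) (#even≤length xs)

#even-swap : ∀ xs → #even (swap xs) ≡ #even xs
#even-swap xs with #odd xs
... | zero  = refl
... | suc _ = #even-evensFirst (#even≤raised xs)

length-swap : ∀ xs → length (swap xs) ≡ length xs
length-swap xs with #odd xs
... | zero  = refl
... | suc _ = trans (length-evensFirst (#even xs) _) (length-raised xs)

-- The length and the number of even parts are preserved, hence so is their difference. This tells
-- from an image which case of `swap` produced it.
#odd-swap : ∀ xs → #odd (swap xs) ≡ #odd xs
#odd-swap xs = +-cancelˡ-≡ (#even xs) (#odd (swap xs)) (#odd xs) (begin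
  #even xs + #odd (swap xs)        ≡⟨ cong (_+ #odd (swap xs)) (#even-swap xs) ⟨
  #even (swap xs) + #odd (swap xs) ≡⟨ #even+#odd (swap xs) ⟩
  length (swap xs)                 ≡⟨ length-swap xs ⟩
  length xs                        ≡⟨ #even+#odd xs ⟨
  #even xs + #odd xs               ∎)
  where open ≡-Reasoning

-- Compared with twice the sum of the values plus the length, the source has an excess of `m` and
-- the image, over its raised values, a deficit of `m`. Raising adds `2m`, which balances the two.
sum-swap : ∀ {xs} → All (0 <_) xs → sum (swap xs) ≡ sum xs
sum-swap {xs} xs>0 with #odd xs in eq
... | zero  = refl
... | suc _ = +-cancelʳ-≡ m _ _ (begin
  sum (evensFirst m (raise m js)) + m                    ≡⟨ sum-evensFirst (#even≤raised xs) ⟩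
  sum (raise m js) + sum (raise m js) + length (raise m js)
    ≡⟨ cong₂ (λ s n → s + s + n) (sum-raise m js 0<length) (length-raised xs) ⟩
  m + sum js + (m + sum js) + length xs                  ≡⟨ regroup m (sum js) (length xs) ⟩
  sum js + sum js + length xs + m + m                    ≡⟨ cong (_+ m) (sum-half xs>0) ⟨
  sum xs + m                                             ∎)
  where
  open ≡-Reasoning
  m = #even xs ; js = map half xs
  0<length : 0 < length js
  0<length = subst (0 <_) (sym (length-map half xs)) (≤-<-trans z≤n (#even<length xs eq))
  regroup : ∀ m J n → m + J + (m + J) + n ≡ J + J + n + m + m
  regroup = solve-∀

-- Injectivity of the map, and the partitions it misses.

Sources Targets : ℕ → List (List ℕ)
Sources n = filter OD/ED? (partitions n)
Targets n = filter ED/OD? (partitions n)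

module _ {n : ℕ} where

  private
    module _ {xs} (xs∈ : xs ∈ Sources n) where
      ∈parts = proj₁ (∈-filter⁻ OD/ED? {xs = partitions n} xs∈)
      od/ed  = proj₂ (∈-filter⁻ OD/ED? {xs = partitions n} xs∈)
      open IsPartition (Equivalence.to (∈-partitions {n}) ∈parts) public
      oddFirst : AllPairs OddFirst xs
      oddFirst = OD/ED⇒OddFirst nonIncreasing od/ed

  swap-∈ : ∀ {xs} → xs ∈ Sources n → swap xs ∈ Targets n
  swap-∈ {xs} xs∈ with #odd xs in eq
  -- With no odd part the comparison of evens with odds is vacuous, and the distinctness conditions
  -- are merely reordered.
  ... | zero  = (∈-filter⁺ ED/OD? (∈parts xs∈)
                  ( All.tabulate (λ _ → All.tabulate λ b∈ _ o → no-odd b∈ o)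
                  , proj₂ (proj₂ (od/ed xs∈)) , proj₁ (proj₂ (od/ed xs∈))))
    where
    no-odd : ∀ {b} {C : Set} → b ∈ xs → Odd b → C
    no-odd b∈ o with filter odd? xs | ∈-filter⁺ odd? b∈ o
    no-odd b∈ o | _ ∷ _ | _ = contradiction eq λ ()
  ... | suc _ = evensFirst-∈
    (subst (#even xs <_) (sym (length-raised xs)) (#even<length xs eq))
    (raise-decreasing (#even xs) (halves-decreasing (positive xs∈) (oddFirst xs∈)))
    (trans (trans (cong sum (sym (swap-some-odd xs eq))) (sum-swap (positive xs∈))) (sums xs∈))

  -- Equal images have equally many odd parts, so both arguments fall under the same case of `swap`.
  -- In the second case the image yields `m` and the raised halves, hence the halves; these and the
  -- number of odd parts fix the partition.
  swap-injective : ∀ {xs ys} → xs ∈ Sources n → ys ∈ Sources n → swap xs ≡ swap ys → xs ≡ ys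
  swap-injective {xs} {ys} xs∈ ys∈ eq = go (#odd xs) refl
    where
    #odd≡ : #odd xs ≡ #odd ys
    #odd≡ = trans (sym (#odd-swap xs)) (trans (cong #odd eq) (#odd-swap ys))
    go : ∀ k → #odd xs ≡ k → xs ≡ ys
    go zero    xs≡k =
      trans (sym (swap-no-odd xs xs≡k)) (trans eq (swap-no-odd ys (trans (sym #odd≡) xs≡k)))
    go (suc k) xs≡k
      with m≡ , raised≡ ← evensFirst-injective (#even≤raised xs) (#even≤raised ys)
             (trans (sym (swap-some-odd xs xs≡k))
               (trans eq (swap-some-odd ys (trans (sym #odd≡) xs≡k)))) =
      halves-injective (positive xs∈) (positive ys∈) (oddFirst xs∈) (oddFirst ys∈) #odd≡
        (raise-injective (#even xs) _ _
          (trans raised≡ (cong (λ m → raise m (map half ys)) (sym m≡))))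

  -- Halves are strictly decreasing before `m` is added to the first, so in an image with an odd
  -- part the two leading values differ by more than `m`.
  swap-misses : ∀ {xs m a b js} → xs ∈ Sources n → m < length (a ∷ b ∷ js) → a ≤ m + b →
                evensFirst m (a ∷ b ∷ js) ≢ swap xs
  swap-misses {xs} {m} {a} {b} {js} xs∈ m< a≤m+b eq = go (#odd xs) refl
    where
    m≡#even : m ≡ #even xs
    m≡#even = trans (sym (#even-evensFirst (<⇒≤ m<))) (trans (cong #even eq) (#even-swap xs))
    #even<len : #even xs < length xs
    #even<len = subst₂ _<_ m≡#even
      (trans (sym (length-evensFirst m _)) (trans (cong length eq) (length-swap xs))) m<
    gap : ∀ {is} → AllPairs _>_ is → a ∷ b ∷ js ≡ raise m is → m + b < a
    gap ((b<i ∷ _) ∷ _) refl = +-monoʳ-< m b<i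
    go : ∀ k → #odd xs ≡ k → _
    -- Without odd parts the number of even parts equals the length, against the strict bound on
    -- `m`.
    go zero    xs≡k = <⇒≢ #even<len
      (trans (sym (+-identityʳ _)) (trans (cong (#even xs +_) (sym xs≡k)) (#even+#odd xs)))
    go (suc k) xs≡k = <⇒≱ (gap (halves-decreasing (positive xs∈) (oddFirst xs∈))
      (trans (proj₂ (evensFirst-injective (<⇒≤ m<) (#even≤raised xs) (trans eq (swap-some-odd xs xs≡k))))
        (cong (λ m → raise m (map half xs)) (sym m≡#even)))) a≤m+b

  swaps : List (List ℕ)
  swaps = map swap (Sources n)

  swaps-unique : Unique swaps
  swaps-unique = map-unique swap-injective (Unique.filter⁺ OD/ED? (partitions-unique n))

  swaps⊆Targets : swaps ⊆ Targets n
  swaps⊆Targets ys∈ with _ , xs∈ , refl ← ∈-map⁻ swap ys∈ = swap-∈ xs∈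

  length-swaps : length swaps ≡ p-od/ed n
  length-swaps = length-map swap (Sources n)

  p-od/ed≤p-ed/od : p-od/ed n ≤ p-ed/od n
  p-od/ed≤p-ed/od = subst (_≤ p-ed/od n) length-swaps
    (length-mono-⊆ (≡-dec _≟_) swaps-unique swaps⊆Targets)

  -- The missed partition put in front of `swaps` gives a duplicate-free list inside `Targets n`
  -- that is one entry longer than `swaps`.
  p-od/ed<p-ed/od : ∀ m {a b js} → m < length (a ∷ b ∷ js) → AllPairs _>_ (a ∷ b ∷ js) →
                    a ≤ m + b → sum (evensFirst m (a ∷ b ∷ js)) ≡ n → p-od/ed n < p-ed/od n
  p-od/ed<p-ed/od m m< js> a≤m+b eq = subst (_< p-ed/od n) length-swaps
    (length-mono-⊆ (≡-dec _≟_) (All.tabulate missed ∷ swaps-unique) λ where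
      (here refl) → evensFirst-∈ m< js> eq
      (there ys∈) → swaps⊆Targets ys∈)
    where
    missed : ∀ {ys} → ys ∈ swaps → _ ≢ ys
    missed ys∈ with _ , xs∈ , refl ← ∈-map⁻ swap ys∈ = swap-misses xs∈ m< a≤m+b

-- With t = q + 2, the missed partitions are (2t+2, 2t+1), (2t+2, 2t+1, 1),
-- (2t+4, 2t, 1) and (2t+2, 2t+1, 3).
strict-from-11 : ∀ d → p-od/ed (11 + d) < p-ed/od (11 + d)
strict-from-11 d with d divMod 4
... | result q 0F refl =
  p-od/ed<p-ed/od {11 + q * 4} 1 {3 + q} {2 + q} {[]} (s≤s (s≤s z≤n))
    ((≤-refl ∷ []) ∷ [] ∷ []) ≤-refl (total q)
  where
  total : ∀ q → 3 + q + (3 + q) + (suc (2 + q + (2 + q)) + 0) ≡ 11 + q * 4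
  total = solve-∀
... | result q 1F refl =
  p-od/ed<p-ed/od {11 + (1 + q * 4)} 1 {3 + q} {2 + q} {0 ∷ []} (s≤s (s≤s z≤n))
    ((≤-refl ∷ s≤s z≤n ∷ []) ∷ (s≤s z≤n ∷ []) ∷ [] ∷ []) ≤-refl (total q)
  where
  total : ∀ q → 3 + q + (3 + q) + (suc (2 + q + (2 + q)) + (1 + 0)) ≡ 11 + (1 + q * 4)
  total = solve-∀
... | result q 2F refl =
  p-od/ed<p-ed/od {11 + (2 + q * 4)} 2 {4 + q} {2 + q} {0 ∷ []} (s≤s (s≤s (s≤s z≤n)))
    ((s≤s (n≤1+n _) ∷ s≤s z≤n ∷ []) ∷ (s≤s z≤n ∷ []) ∷ [] ∷ []) ≤-refl (total q)
  where
  total : ∀ q → 4 + q + (4 + q) + ((2 + q + (2 + q)) + (1 + 0)) ≡ 11 + (2 + q * 4)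
  total = solve-∀
... | result q 3F refl =
  p-od/ed<p-ed/od {11 + (3 + q * 4)} 1 {3 + q} {2 + q} {1 ∷ []} (s≤s (s≤s z≤n))
    ((≤-refl ∷ s≤s (s≤s z≤n) ∷ []) ∷ (s≤s (s≤s z≤n) ∷ []) ∷ [] ∷ []) ≤-refl (total q)
  where
  total : ∀ q → 3 + q + (3 + q) + (suc (2 + q + (2 + q)) + (3 + 0)) ≡ 11 + (3 + q * 4)
  total = solve-∀

theorem3p1 : (∀ (n : ℕ) → p-od/ed n ≤ p-ed/od n)
    × (∀ (n : ℕ) → n ≥ 11 → p-od/ed n < p-ed/od n)
theorem3p1 = (λ n → p-od/ed≤p-ed/od {n}) , λ n n≥11 →
  subst (λ n → p-od/ed n < p-ed/od n) (m+[n∸m]≡n n≥11) (strict-from-11 (n ∸ 11))
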